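{- Let $s$ be a weak composition. Define the edge labeling $\lambda$ of the Hasse diagram of the $s$-Tamari lattice by $\lambda(T,Z)=a$ for every cover relation $T\lessdot_{Tam} Z$, where $(a,b)$ is the unique Tamari tree ascent of $T$ such that $Z$ is the $s$-Tamari rotation of $T$ along $(a,b)$. Then $\lambda$ is an SB-labeling of the $s$-Tamari lattice.
   Context: A weak composition is a sequence $s=(s(1),\dots,s(n))$ of nonnegative integers. An $s$-decreasing tree is a planar rooted tree $T$ whose internal vertices are labeled bijectively by $1,\dots,n$ (leaves unlabeled), such that internal vertex $i$ has exactly $s(i)+1$ children, indexed $0,\dots,s(i)$ from left to right, and every labeled descendant of $i$ has label smaller than $i$. $T^i_j$ denotes the full subtree rooted at the $j$-th child of $i$. For $1\le x<y\le n$ the cardinality $\#_T(y,x)$ is: $0$ if $x$ is left of $y$ in $T$ or $x\in T^y_0$; $i$ if $x\in T^y_i$ with $0<i<s(y)$; $s(y)$ if $x\in T^y_{s(y)}$ or $x$ is right of $y$. $\mathrm{inv}(T)$ is the multiset of pairs $(y,x)$, $x<y$, with multiplicity $\#_T(y,x)$. For multisets of such pairs: $I\subseteq J$ is multiplicity-wise inclusion; $I+(b,a)$ increases the multiplicity of $(b,a)$ by one (capped at $s(b)$); $I$ is transitive if for all $a<b<c$ with $\#_I(c,b)=i$, either $\#_I(b,a)=0$ or $\#_I(c,a)\ge i$; $I^{tc}$ is the smallest transitive multiset containing $I$. The $s$-weak order on $s$-decreasing trees is $T\preceq Z$ iff $\mathrm{inv}(T)\subseteq\mathrm{inv}(Z)$;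 it is a lattice. An $s$-Tamari tree is an $s$-decreasing tree $T$ with $\#_T(c,a)\le\#_T(c,b)$ for all $a<b<c$. The $s$-Tamari trees form a sublattice of $s$-weak order, the $s$-Tamari lattice (order $\preceq_{Tam}$, covers $\lessdot_{Tam}$, joins equal to those in $s$-weak order). For $a<b$, $(a,b)$ is a Tamari tree ascent of an $s$-Tamari tree $T$ if $a$ is a child of $b$ and $\#_T(b,a)<s(b)$. For such $(a,b)$, $(\mathrm{inv}(T)+(b,a))^{tc}=\mathrm{inv}(Z)$ for a unique $s$-Tamari tree $Z$, the $s$-Tamari rotation of $T$ along $(a,b)$; it is known that $T\lessdot_{Tam}Z$ iff $Z$ is the $s$-Tamari rotation of $T$ along a unique Tamari tree ascent of $T$. An SB-labeling of a finite lattice $L$ is an edge labeling $\lambda$ such that for all $u,v,w$ with $v\ne w$ both covering $u$: (i) $\lambda(u,v)\ne\lambda(u,w)$; (ii) every saturated chain from $u$ to $v\vee w$ uses both labels $\lambda(u,v),\lambda(u,w)$ a positive number of times; (iii) no such chain uses any other label. -}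

module Defs where

open import Data.Nat using (ℕ; zero; suc; _≤_; _<_; _≡ᵇ_; _<ᵇ_; _⊓_)
open import Data.Bool using (Bool; true; false; if_then_else_; _∧_)
open import Data.List using (List; []; _∷_; _++_; length; map; upTo)
open import Data.List.Relation.Unary.All using (All)
open import Data.List.Relation.Binary.Permutation.Propositional using (_↭_)
open import Data.Maybe using (Maybe; just; nothing; _<∣>_)
import Data.Maybe as Maybe
open import Data.Product using (_×_; ∃; ∃-syntax)
open import Data.Sum using (_⊎_)
open import Relation.Binary.PropositionalEquality using (_≡_; _≢_)

-- Weak compositions: s = (s(1),...,s(n)) given as a list; n = length s.
-- val s i = s(i) for 1 ≤ i ≤ n (1-indexed), and 0 otherwise.

val : List ℕ → ℕ → ℕ
val []       _             = 0
val (x ∷ xs) zero          = 0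
val (x ∷ xs) (suc zero)    = x
val (x ∷ xs) (suc (suc i)) = val xs (suc i)

data Tree : Set where
  leaf : Tree
  node : ℕ → List Tree → Tree

mutual
  labels : Tree → List ℕ
  labels leaf        = []
  labels (node i ts) = i ∷ labelsF ts

  labelsF : List Tree → List ℕ
  labelsF []       = []
  labelsF (t ∷ ts) = labels t ++ labelsF ts

data Shape (s : List ℕ) : Tree → Set where
  leaf : Shape s leaf
  node : ∀ {i ts} →
         length ts ≡ suc (val s i) →
         All (λ t → All (λ j → j < i) (labels t)) ts →
         All (Shape s) ts →
         Shape s (node i ts)

range1 : ℕ → List ℕ
range1 n = map suc (upTo n)

IsSDecreasing : List ℕ → Tree → Set
IsSDecreasing s T = Shape s T × (labels T ↭ range1 (length s))

mutual
  addr : ℕ → Tree → Maybe (List ℕ)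
  addr x leaf        = nothing
  addr x (node i ts) = if x ≡ᵇ i then just [] else addrF x 0 ts

  addrF : ℕ → ℕ → List Tree → Maybe (List ℕ)
  addrF x k []       = nothing
  addrF x k (t ∷ ts) = Maybe.map (k ∷_) (addr x t) <∣> addrF x (suc k) ts

-- Cardinality from addresses py (of y) and px (of x), sy = s(y):
--  * x ∈ T^y_i (py is a proper prefix of px, next index i) gives i
--    (this is 0 for i = 0 and s(y) for i = s(y), as in the definition);
--  * x left of y (first differing index smaller for x) gives 0;
--  * x right of y (first differing index larger for x) gives s(y);
--  * remaining cases (x = y, x an ancestor of y) cannot occur for x < y.
cardAddr : ℕ → List ℕ → List ℕ → ℕ
cardAddr sy []       []       = 0
cardAddr sy []       (i ∷ px) = i
cardAddr sy (j ∷ py) []       = 0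
cardAddr sy (j ∷ py) (k ∷ px) =
  if j ≡ᵇ k then cardAddr sy py px
  else (if k <ᵇ j then 0 else sy)

card : List ℕ → Tree → ℕ → ℕ → ℕ
card s T y x with addr y T | addr x T
... | just py | just px = cardAddr (val s y) py px
... | _       | _       = 0

-- Multisets of pairs (y,x), 1 ≤ x < y ≤ n, as multiplicity functions
-- I y x = #_I(y,x) (values outside that range are ignored).

MSet : Set
MSet = ℕ → ℕ → ℕ

inv : List ℕ → Tree → MSet
inv s T y x = card s T y x

Sub : ℕ → MSet → MSet → Set
Sub n I J = ∀ x y → 1 ≤ x → x < y → y ≤ n → I y x ≤ J y x

Transitive : ℕ → MSet → Set
Transitive n I = ∀ a b c → 1 ≤ a → a < b → b < c → c ≤ n →
                 (I b a ≡ 0) ⊎ (I c b ≤ I c a)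

plus : List ℕ → MSet → ℕ → ℕ → MSet
plus s I b a y x =
  if (y ≡ᵇ b) ∧ (x ≡ᵇ a) then suc (I y x) ⊓ val s b else I y x

IsTC : ℕ → MSet → MSet → Set
IsTC n I K = Sub n I K × Transitive n K ×
             (∀ K' → Sub n I K' → Transitive n K' → Sub n K K')

WeakLe : List ℕ → Tree → Tree → Set
WeakLe s T Z = Sub (length s) (inv s T) (inv s Z)

IsTamari : List ℕ → Tree → Set
IsTamari s T = IsSDecreasing s T ×
  (∀ a b c → 1 ≤ a → a < b → b < c → c ≤ length s →
     card s T c a ≤ card s T c b)

TamCover : List ℕ → Tree → Tree → Set
TamCover s T Z = IsTamari s T × IsTamari s Z × WeakLe s T Z × T ≢ Z ×
  (∀ W → IsTamari s W → WeakLe s T W → WeakLe s W Z → (W ≡ T) ⊎ (W ≡ Z))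

ChildOf : Tree → ℕ → ℕ → Set
ChildOf T a b = ∃[ pb ] ∃[ i ] (addr b T ≡ just pb × addr a T ≡ just (pb ++ i ∷ []))

Ascent : List ℕ → Tree → ℕ → ℕ → Set
Ascent s T a b = a < b × ChildOf T a b × card s T b a < val s b

Rotation : List ℕ → Tree → ℕ → ℕ → Tree → Set
Rotation s T a b Z = IsTamari s Z × IsTC (length s) (plus s (inv s T) b a) (inv s Z)

IsJoin : List ℕ → Tree → Tree → Tree → Set
IsJoin s v w J = IsTamari s J × WeakLe s v J × WeakLe s w J ×
  (∀ U → IsTamari s U → WeakLe s v U → WeakLe s w U → WeakLe s J U)

data SatChain (s : List ℕ) (lab : Tree → Tree → ℕ) : Tree → Tree → List ℕ → Set where
  done : ∀ {T} → SatChain s lab T T []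
  step : ∀ {T Z W ls} → TamCover s T Z → SatChain s lab Z W ls →
         SatChain s lab T W (lab T Z ∷ ls)

{-# OPTIONS --safe #-}
module Submission where

-- In a Tamari tree a smaller label is never to the right of a larger one, so #(a,e) > 0 makes e
-- a descendant of a; in particular #(a,e) = 0 if e is a child of d and e < a < d.  Minimality
-- of the transitive closure shows that rotating T along (e,d) raises #(y,x) only if y = d and
-- either x = e or x < e with #(e,x) > 0.
--
-- Let v and w be the rotations of u along (a,b) and (a′,b′).  If a chain from u to v ∨ w
-- contained a step at T with label e ∉ {a , a′}, ascent (e,d) and k = #(d,e), then v and w
-- would both lie below the explicit Tamari tree K with #(d,x) = k for x ≤ e, #(y,x) = 0 for
-- x ≤ e < y < d, and all other cardinalities maximal.  So v ∨ w ≤ K would contradict the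
-- fact that the step raises #(d,e) above k.  Conversely #(b,a) must grow along the chain, and
-- a step labelled a′ can make it grow only after a step labelled a.

open import Defs
open import Data.Bool using (true; false; T; if_then_else_; _∧_)
open import Data.Empty using (⊥-elim)
open import Data.Unit using (tt)
open import Data.Nat using (ℕ; zero; suc; _+_; _∸_; _≤_; _<_; z≤n; s≤s; _≡ᵇ_; _<ᵇ_; _⊓_; _≟_; _<?_; _≤?_)
open import Data.Nat.Properties
open import Data.List using (List; []; _∷_; _++_; length; map; upTo; downFrom; replicate)
open import Data.List.Properties using (++-assoc; ++-identityʳ; length-++; length-replicate; reverse-upTo; ∷-injectiveˡ; ∷-injectiveʳ; ++-cancelˡ)
open import Data.List.Relation.Unary.All as All using (All; []; _∷_)
import Data.List.Relation.Unary.All.Properties as All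
open import Data.List.Relation.Unary.Any using (here; there)
open import Data.List.Relation.Unary.AllPairs using ([]; _∷_)
open import Data.List.Relation.Unary.Unique.Propositional using (Unique)
import Data.List.Relation.Unary.Unique.Propositional.Properties as Unique
open import Data.List.Membership.Propositional using (_∈_; _∉_)
open import Data.List.Membership.Propositional.Properties using (∈-++⁺ˡ; ∈-++⁺ʳ; ∈-map⁻; ∈-upTo⁻)
open import Data.List.Relation.Binary.Permutation.Propositional using (_↭_; ↭-sym; ↭-trans; ↭-reflexive; ↭⇒↭ₛ; prep)
open import Data.List.Relation.Binary.Permutation.Propositional.Properties using (∈-resp-↭; All-resp-↭; ++⁺ˡ; ++-comm; map⁺; ↭-reverse)
import Data.List.Relation.Binary.Permutation.Setoid.Properties as Permutationₛ
open import Data.Maybe using (just; nothing)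
open import Data.Maybe.Properties using (just-injective)
open import Data.Product using (_×_; _,_; ∃-syntax; proj₁; proj₂)
open import Data.Sum using (_⊎_; inj₁; inj₂; swap)
open import Relation.Binary.PropositionalEquality
open import Relation.Nullary using (¬_; Dec; yes; no; contradiction)
open import Relation.Nullary.Decidable using (_×-dec_; _⊎-dec_)

private variable
  s p q r ls : List ℕ
  ts : List Tree
  t T₁ T₂ : Tree
  a b c d e i j k x y : ℕ

-- Boolean equality and lists without repetition.

≡ᵇ-refl : ∀ n → (n ≡ᵇ n) ≡ true
≡ᵇ-refl zero    = refl
≡ᵇ-refl (suc n) = ≡ᵇ-refl n

≢⇒≡ᵇ-false : ∀ m n → m ≢ n → (m ≡ᵇ n) ≡ false
≢⇒≡ᵇ-false m n m≢n with m ≡ᵇ n in eq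
... | false = refl
... | true  = contradiction (≡ᵇ⇒≡ m n (subst T (sym eq) tt)) m≢n

unique-++⁻ : ∀ xs {ys : List ℕ} → Unique (xs ++ ys) →
             Unique xs × Unique ys × (∀ {z} → z ∈ xs → z ∉ ys)
unique-++⁻ []       u        = [] , u , λ ()
unique-++⁻ (z ∷ xs) (z# ∷ u) with unique-++⁻ xs u
... | uxs , uys , disj = All.++⁻ˡ xs z# ∷ uxs , uys ,
  λ { (here refl) z∈ys → All.lookup (All.++⁻ʳ xs z#) z∈ys refl
    ; (there z∈xs) → disj z∈xs }

-- Positions of labels in a tree.

data Nth : List Tree → ℕ → Tree → Set where
  zero : Nth (t ∷ ts) zero t
  suc  : ∀ {t′} → Nth ts i t → Nth (t′ ∷ ts) (suc i) t

Nth-functional : Nth ts i T₁ → Nth ts i T₂ → T₁ ≡ T₂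
Nth-functional zero    zero    = refl
Nth-functional (suc m) (suc n) = Nth-functional m n

Nth-lookup : {P : Tree → Set} → All P ts → Nth ts i t → P t
Nth-lookup (pt ∷ _) zero    = pt
Nth-lookup (_ ∷ ps) (suc n) = Nth-lookup ps n

Nth-< : Nth ts i t → i < length ts
Nth-< zero    = s≤s z≤n
Nth-< (suc n) = s≤s (Nth-< n)

Nth-labels : Nth ts i t → x ∈ labels t → x ∈ labelsF ts
Nth-labels zero                    x∈ = ∈-++⁺ˡ x∈
Nth-labels (suc {ts = ts} {t′ = t′} n) x∈ = ∈-++⁺ʳ (labels t′) (Nth-labels n x∈)

-- Relational counterpart of `addr`: paths can be analysed by induction, free of the search order
-- and of any assumption that labels are distinct.
data At (x : ℕ) : Tree → List ℕ → Set where
  root  : At x (node x ts) []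
  child : Nth ts i t → At x t p → At x (node y ts) (i ∷ p)

At-∈ : At x T₁ p → x ∈ labels T₁
At-∈ root        = here refl
At-∈ (child n α) = there (Nth-labels n (At-∈ α))

At-functional : At x T₁ p → At y T₁ p → x ≡ y
At-functional root        root        = refl
At-functional (child m α) (child n β) with refl ← Nth-functional m n = At-functional α β

At-prefix : ∀ p → At x T₁ (p ++ q) → ∃[ y ] At y T₁ p
At-prefix {q = []}    []      root        = _ , root
At-prefix {q = _ ∷ _} []      (child _ _) = _ , root
At-prefix             (_ ∷ p) (child n α) with y , β ← At-prefix p α = y , child n β

At-< : Shape s T₁ → At y T₁ p → At x T₁ (p ++ i ∷ q) → x < y
At-< (node _ below _) root        (child n β) = All.lookup (Nth-lookup below n) (At-∈ β)
At-< (node _ _ shs)   (child m α) (child n β) with refl ← Nth-functional m n =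
  At-< (Nth-lookup shs m) α β

At-≤ : Shape s T₁ → At y T₁ p → At x T₁ (p ++ q) → x ≤ y
At-≤ {p = p} {q = []} sh α β rewrite ++-identityʳ p = ≤-reflexive (At-functional β α)
At-≤ {q = _ ∷ _}      sh α β = <⇒≤ (At-< sh α β)

At-index : Shape s T₁ → At y T₁ p → At x T₁ (p ++ i ∷ q) → i ≤ val s y
At-index (node len _ _) root        (child n β) = ≤-pred (subst (_ <_) len (Nth-< n))
At-index (node _ _ shs) (child m α) (child n β) with refl ← Nth-functional m n =
  At-index (Nth-lookup shs m) α β

mutual
  addr-sound : ∀ T → addr x T ≡ just p → At x T p
  addr-sound {x} (node i ts) eq with x ≡ᵇ i in x≡ᵇi
  addr-sound {x} (node i ts) refl | true
    rewrite ≡ᵇ⇒≡ x i (subst T (sym x≡ᵇi) tt) = root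
  ... | false with j , t , q , refl , n , α ← addrF-sound 0 ts eq = child n α

  addrF-sound : ∀ k ts → addrF x k ts ≡ just p →
                ∃[ i ] ∃[ t ] ∃[ q ] (p ≡ k + i ∷ q × Nth ts i t × At x t q)
  addrF-sound {x} k (t ∷ ts) eq with addr x t in found
  addrF-sound k (t ∷ ts) refl | just q =
    0 , t , q , cong (_∷ q) (sym (+-identityʳ k)) , zero , addr-sound t found
  ... | nothing with i , t′ , q , refl , n , α ← addrF-sound (suc k) ts eq =
    suc i , t′ , q , cong (_∷ q) (sym (+-suc k i)) , suc n , α

addr-∉ : ∀ T → x ∉ labels T → addr x T ≡ nothing
addr-∉ {x} T x∉ with addr x T in found
... | nothing = refl
... | just _  = contradiction (At-∈ (addr-sound T found)) x∉

mutual
  -- Distinctness matters because `addr` stops at the first occurrence of a label.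
  At⇒addr : Unique (labels T₁) → At x T₁ p → addr x T₁ ≡ just p
  At⇒addr {x = x} u root rewrite ≡ᵇ-refl x = refl
  At⇒addr {x = x} (y# ∷ u) (child {y = y} n α)
    rewrite ≢⇒≡ᵇ-false x y (λ x≡y → All.lookup y# (Nth-labels n (At-∈ α)) (sym x≡y)) =
    At⇒addrF 0 u n α

  At⇒addrF : ∀ k → Unique (labelsF ts) → Nth ts i t → At x t p → addrF x k ts ≡ just (k + i ∷ p)
  At⇒addrF k u (zero {t = t}) α
    rewrite At⇒addr (proj₁ (unique-++⁻ (labels t) u)) α | +-identityʳ k = refl
  At⇒addrF {i = suc i} {x = x} k u (suc {t′ = t′} n) α with unique-++⁻ (labels t′) u
  ... | _ , uts , disj
    rewrite addr-∉ {x} t′ (λ x∈ → disj x∈ (Nth-labels n (At-∈ α))) | +-suc k i =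
    At⇒addrF (suc k) uts n α

label-bounds : IsSDecreasing s T₁ → At x T₁ p → 1 ≤ x × x ≤ length s
label-bounds (_ , perm) α with ∈-map⁻ suc (∈-resp-↭ perm (At-∈ α))
... | _ , m∈ , refl = s≤s z≤n , ∈-upTo⁻ m∈

labels-unique : IsSDecreasing s T₁ → Unique (labels T₁)
labels-unique {s} (_ , perm) =
  Permutationₛ.Unique-resp-↭ (setoid ℕ) (↭⇒↭ₛ (↭-sym perm))
    (Unique.map⁺ suc-injective (Unique.upTo⁺ (length s)))

At-addr : IsSDecreasing s T₁ → At x T₁ p → addr x T₁ ≡ just p
At-addr sd = At⇒addr (labels-unique sd)

At-unique : IsSDecreasing s T₁ → At x T₁ p → At x T₁ q → p ≡ q
At-unique sd α β = just-injective (trans (sym (At-addr sd α)) (At-addr sd β))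

-- Cardinalities read off from addresses.

card-At : IsSDecreasing s T₁ → At y T₁ p → At x T₁ q → card s T₁ y x ≡ cardAddr (val s y) p q
card-At sd α β rewrite At-addr sd α | At-addr sd β = refl

card-view : ∀ s T y x → card s T y x ≡ 0 ⊎
            (∃[ p ] ∃[ q ] (At y T p × At x T q × card s T y x ≡ cardAddr (val s y) p q))
card-view s T y x with addr y T in eqy | addr x T in eqx
... | just p  | just q  = inj₂ (p , q , addr-sound T eqy , addr-sound T eqx , refl)
... | just _  | nothing = inj₁ refl
... | nothing | _       = inj₁ refl

cardAddr-descendant : ∀ m p → cardAddr m p (p ++ i ∷ q) ≡ i
cardAddr-descendant m []      = refl
cardAddr-descendant m (j ∷ p) rewrite ≡ᵇ-refl j = cardAddr-descendant m p

cardAddr-diverge : ∀ m r → j ≢ k → cardAddr m (r ++ j ∷ p) (r ++ k ∷ q) ≡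
                   (if k <ᵇ j then 0 else m)
cardAddr-diverge {j} {k} m [] j≢k rewrite ≢⇒≡ᵇ-false j k j≢k = refl
cardAddr-diverge m (i ∷ r) j≢k rewrite ≡ᵇ-refl i = cardAddr-diverge m r j≢k

cardAddr-left : ∀ m r → k < j → cardAddr m (r ++ j ∷ p) (r ++ k ∷ q) ≡ 0
cardAddr-left {k} {j} {p} {q} m r k<j
  rewrite cardAddr-diverge {p = p} {q = q} m r (>⇒≢ k<j) with k <ᵇ j in eq
... | true  = refl
... | false = ⊥-elim (subst T eq (<⇒<ᵇ k<j))

-- Unless `p′` is a prefix of `p`, the value is settled before `p′` ends, so whatever extends `p′`
-- has no influence.
cardAddr-append : ∀ m p p′ q → (∀ r → p ≢ p′ ++ r) → cardAddr m p (p′ ++ q) ≡ cardAddr m p p′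
cardAddr-append m p        []       q apart = contradiction refl (apart p)
cardAddr-append m []       (_ ∷ _)  q apart = refl
cardAddr-append m (j ∷ p)  (k ∷ p′) q apart with j ≡ᵇ k in eq
... | false = refl
... | true  = cardAddr-append m p p′ q
  λ r p≡ → apart r (cong₂ _∷_ (≡ᵇ⇒≡ j k (subst T (sym eq) tt)) p≡)

cardAddr-≤ : ∀ m p q → (∀ i r → q ≡ p ++ i ∷ r → i ≤ m) → cardAddr m p q ≤ m
cardAddr-≤ m []      []      h = z≤n
cardAddr-≤ m []      (i ∷ q) h = h i q refl
cardAddr-≤ m (j ∷ p) []      h = z≤n
cardAddr-≤ m (j ∷ p) (k ∷ q) h with j ≡ᵇ k in eq
... | true  = cardAddr-≤ m p q
  λ i r q≡ → h i r (cong₂ _∷_ (sym (≡ᵇ⇒≡ j k (subst T (sym eq) tt))) q≡)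
... | false with k <ᵇ j
...   | true  = z≤n
...   | false = ≤-refl

cardAddr-positive : ∀ m p q → 0 < cardAddr m p q →
  (∃[ i ] ∃[ r ] q ≡ p ++ i ∷ r) ⊎
  (∃[ r ] ∃[ j ] ∃[ k ] ∃[ p′ ] ∃[ q′ ] (p ≡ r ++ j ∷ p′ × q ≡ r ++ k ∷ q′ × j < k))
cardAddr-positive m []      (i ∷ q) _ = inj₁ (i , q , refl)
cardAddr-positive m (j ∷ p) (k ∷ q) h with j ≡ᵇ k in eq
cardAddr-positive m (j ∷ p) (k ∷ q) h | true
  with refl ← ≡ᵇ⇒≡ j k (subst T (sym eq) tt) | cardAddr-positive m p q h
... | inj₁ (i , r , refl) = inj₁ (i , r , refl)
... | inj₂ (r , j′ , k′ , p′ , q′ , refl , refl , lt) =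
  inj₂ (j ∷ r , j′ , k′ , p′ , q′ , refl , refl , lt)
cardAddr-positive m (j ∷ p) (k ∷ q) h | false with k <ᵇ j in lt
... | false = inj₂ ([] , j , k , p , q , refl , refl ,
  ≤∧≢⇒< (≮⇒≥ (λ k<j → subst T lt (<⇒<ᵇ k<j)))
        (λ j≡k → subst T eq (≡⇒≡ᵇ j k j≡k)))

card-≤ : IsSDecreasing s T₁ → ∀ y x → card s T₁ y x ≤ val s y
card-≤ {s} {T₁} sd y x with card-view s T₁ y x
... | inj₁ eq = subst (_≤ val s y) (sym eq) z≤n
... | inj₂ (p , q , α , β , eq) = subst (_≤ val s y) (sym eq)
  (cardAddr-≤ (val s y) p q λ { i r refl → At-index (proj₁ sd) α β })

-- Labels decrease along paths, so an address of the larger `c` never extends that of `b`, and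
-- `cardAddr-append` applies.
card-descendant : IsSDecreasing s T₁ → At b T₁ p → At a T₁ (p ++ q) → b < c →
                  card s T₁ c a ≡ card s T₁ c b
card-descendant {s} {T₁} {p = p} {q = q} {c = c} sd α β b<c
  rewrite At-addr sd α | At-addr sd β with addr c T₁ in eq
... | nothing = refl
... | just pc = cardAddr-append (val s c) pc p q
  λ { r refl → <⇒≱ b<c (At-≤ (proj₁ sd) α (addr-sound T₁ eq)) }

-- Ancestors and children in Tamari trees.

-- In a Tamari tree a smaller label never stands to the right of a larger one: otherwise
-- the two would violate the Tamari inequality at their lowest common ancestor.
positive⇒descendant : IsTamari s T₁ → 1 ≤ x → 0 < card s T₁ y x → x < y →
                      ∃[ p ] ∃[ i ] ∃[ q ] (At y T₁ p × At x T₁ (p ++ i ∷ q))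
positive⇒descendant {s} {T₁} {x} {y} (sd , tam) 1≤x pos x<y with card-view s T₁ y x
... | inj₁ eq = contradiction (subst (0 <_) eq pos) λ ()
... | inj₂ (p , q , α , β , eq) with cardAddr-positive (val s y) p q (subst (0 <_) eq pos)
...   | inj₁ (i , r , refl) = p , i , r , α , β
...   | inj₂ (r , j , k , p′ , q′ , refl , refl , j<k) with At-prefix r α
...     | c , γ = contradiction
  (tam x y c 1≤x x<y (At-< (proj₁ sd) γ α) (proj₂ (label-bounds sd γ)))
  (<⇒≱ (subst₂ _<_
    (sym (trans (card-At sd γ α) (cardAddr-descendant (val s c) r)))
    (sym (trans (card-At sd γ β) (cardAddr-descendant (val s c) r))) j<k))

-- A positive #(b,a) puts `a` below `b`, and then every larger `c` has the same cardinality with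
-- both.
inv-transitive : IsTamari s T₁ → Transitive (length s) (inv s T₁)
inv-transitive {s} {T₁} tam a b c 1≤a a<b b<c _ with card s T₁ b a in eq
... | zero  = inj₁ refl
... | suc _
  with p , i , q , α , β ← positive⇒descendant {T₁ = T₁} tam 1≤a
                             (subst (0 <_) (sym eq) (s≤s z≤n)) a<b =
  inj₂ (≤-reflexive (sym (card-descendant (proj₁ tam) α β b<c)))

child-At : ChildOf T₁ a b → ∃[ p ] ∃[ i ] (At b T₁ p × At a T₁ (p ++ i ∷ []))
child-At {T₁} (p , i , eqb , eqa) = p , i , addr-sound T₁ eqb , addr-sound T₁ eqa

-- In terms of paths: a proper ancestor of a node is its parent or an ancestor of its parent.
snoc-prefix : ∀ p p′ → p ++ i ∷ q ≡ p′ ++ j ∷ [] → ∃[ r ] p′ ≡ p ++ r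
snoc-prefix []      p′       eq = p′ , refl
snoc-prefix (k ∷ p) (l ∷ p′) eq with refl ← ∷-injectiveˡ eq
  with r , p≡ ← snoc-prefix p p′ (∷-injectiveʳ eq) = r , cong (k ∷_) p≡
snoc-prefix (k ∷ [])    [] ()
snoc-prefix (k ∷ _ ∷ _) [] ()

-- A positive value would make `a` a proper ancestor of `e`; the parent `d` would then lie at or
-- below `a`, forcing d ≤ a.
child-between : IsTamari s T₁ → ChildOf T₁ e d → e < a → a < d → card s T₁ a e ≡ 0
child-between {s} {T₁} {e} {d} {a} tam ch e<a a<d with card s T₁ a e in eq | child-At ch
... | zero  | _ = refl
... | suc _ | p′ , j , δ , ε
  with p , i , q , α , β ← positive⇒descendant {T₁ = T₁} tam (proj₁ (label-bounds (proj₁ tam) ε))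
                             (subst (0 <_) (sym eq) (s≤s z≤n)) e<a
  with r , refl ← snoc-prefix p p′ (At-unique (proj₁ tam) β ε) =
  contradiction (At-≤ (proj₁ (proj₁ tam)) α δ) (<⇒≱ a<d)

parent-unique : IsSDecreasing s T₁ → ChildOf T₁ a b → ChildOf T₁ a c → b ≡ c
parent-unique sd chb chc with child-At chb | child-At chc
... | p , i , α , β | p′ , j , α′ , β′
  with r , refl ← snoc-prefix p p′ (At-unique sd β β′)
  -- Cancelling `p` equates a one-entry list with `r` followed by one entry, so `r` is empty.
  with r | ++-cancelˡ p _ _ (trans (At-unique sd β β′) (++-assoc p r _))
... | []        | _ = At-functional α (subst (At _ _) (++-identityʳ p) α′)
... | _ ∷ []    | ()
... | _ ∷ _ ∷ _ | ()

-- Which cardinalities a rotation can raise.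

-- In a Tamari tree the second alternative describes the `x` below `e` outside its leftmost subtree;
-- transitivity forces #(d,x) up together with #(d,e).
Raised : List ℕ → Tree → (e d y x : ℕ) → Set
Raised s T e d y x = y ≡ d × (x ≡ e ⊎ (x < e × 0 < card s T e x))

raised? : ∀ s T e d y x → Dec (Raised s T e d y x)
raised? s T e d y x = (y ≟ d) ×-dec ((x ≟ e) ⊎-dec ((x <? e) ×-dec (0 <? card s T e x)))

-- A transitive multiset containing inv T + (d,e), hence an upper bound for its closure.
raise : List ℕ → Tree → (e d : ℕ) → MSet
raise s T e d y x with raised? s T e d y x
... | yes _ = suc (card s T d e)
... | no  _ = card s T y x

module _ (tam : IsTamari s T₁) (ch : ChildOf T₁ e d) (e<d : e < d) where

  -- By the Tamari inequality at `d`, assigning `suc (card s T d e)` to the raised entries never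
  -- lowers one.
  raised-≤ : 1 ≤ x → d ≤ length s → Raised s T₁ e d y x → card s T₁ y x ≤ card s T₁ d e
  raised-≤ 1≤x d≤n (refl , inj₁ refl)      = ≤-refl
  raised-≤ 1≤x d≤n (refl , inj₂ (x<e , _)) = proj₂ tam _ _ _ 1≤x x<e e<d d≤n

  plus⊆raise : Sub (length s) (plus s (inv s T₁) d e) (raise s T₁ e d)
  plus⊆raise x y 1≤x x<y y≤n with raised? s T₁ e d y x
  ... | yes R@(refl , _) with (y ≡ᵇ d) ∧ (x ≡ᵇ e) in eq
  ...   | true  = ≤-trans (m⊓n≤m _ (val s d)) (s≤s (raised-≤ 1≤x y≤n R))
  ...   | false = m≤n⇒m≤1+n (raised-≤ 1≤x y≤n R)
  plus⊆raise x y 1≤x x<y y≤n | no ¬R with y ≡ᵇ d in eqy | x ≡ᵇ e in eqx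
  ... | true  | true  = contradiction
    (≡ᵇ⇒≡ y d (subst T (sym eqy) tt) , inj₁ (≡ᵇ⇒≡ x e (subst T (sym eqx) tt))) ¬R
  ... | true  | false = ≤-refl
  ... | false | _     = ≤-refl

  card≤raise : 1 ≤ x → y ≤ length s → card s T₁ y x ≤ raise s T₁ e d y x
  card≤raise {x} {y} 1≤x y≤n with raised? s T₁ e d y x
  ... | yes R@(refl , _) = m≤n⇒m≤1+n (raised-≤ 1≤x y≤n R)
  ... | no _             = ≤-refl

  -- If (b,a) is raised, then b = d, and any c > d has equal cardinality with `d` and its child `e`,
  -- and at least that with the `a` in question. If (c,b) is raised and #(b,a) > 0, then
  -- transitivity of `inv` makes (c,a) raised as well.
  raise-transitive : Transitive (length s) (raise s T₁ e d)
  raise-transitive a b c 1≤a a<b b<c c≤n with raised? s T₁ e d b a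
  raise-transitive a b c 1≤a a<b b<c c≤n | yes (refl , Ra) with raised? s T₁ e d c b
  ... | yes (c≡d , _) = contradiction (sym c≡d) (<⇒≢ b<c)
  ... | no _ = inj₂ (≤-trans (rise Ra) (card≤raise 1≤a c≤n))
    where
    parent : card s T₁ c e ≡ card s T₁ c d
    parent with _ , _ , δ , ε ← child-At ch = card-descendant (proj₁ tam) δ ε b<c
    rise : a ≡ e ⊎ (a < e × 0 < card s T₁ e a) → card s T₁ c d ≤ card s T₁ c a
    rise (inj₁ refl) = ≤-reflexive (sym parent)
    rise (inj₂ (a<e , pos)) with inv-transitive {T₁ = T₁} tam a e c 1≤a a<e (<-trans e<d b<c) c≤n
    ... | inj₁ eq = contradiction (subst (0 <_) eq pos) λ ()
    ... | inj₂ le = subst (_≤ card s T₁ c a) parent le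
  raise-transitive a b c 1≤a a<b b<c c≤n | no ¬Rba
    with inv-transitive {T₁ = T₁} tam a b c 1≤a a<b b<c c≤n
  ... | inj₁ eq = inj₁ eq
  ... | inj₂ le with raised? s T₁ e d c b
  ...   | no _ = inj₂ (≤-trans le (card≤raise 1≤a c≤n))
  ...   | yes (refl , Rb) with card s T₁ b a in eqba
  ...     | zero  = inj₁ refl
  ...     | suc m with raised? s T₁ e d c a
  ...       | yes _ = inj₂ ≤-refl
  ...       | no ¬R = contradiction (refl , inj₂ (below Rb)) ¬R
    where
    below : b ≡ e ⊎ (b < e × 0 < card s T₁ e b) → a < e × 0 < card s T₁ e a
    below (inj₁ refl) = a<b , subst (0 <_) (sym eqba) (s≤s z≤n)
    below (inj₂ (b<e , pos))
      with inv-transitive {T₁ = T₁} tam a b e 1≤a a<b b<e (<⇒≤ (<-≤-trans e<d c≤n))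
    ... | inj₁ eq = contradiction (trans (sym eqba) eq) λ ()
    ... | inj₂ le′ = <-trans a<b b<e , <-≤-trans pos le′

  rotation-raises : ∀ {Z} → Rotation s T₁ e d Z → 1 ≤ x → x < y → y ≤ length s →
                    card s Z y x ≤ card s T₁ y x ⊎ Raised s T₁ e d y x
  rotation-raises {x} {y} (_ , _ , _ , least) 1≤x x<y y≤n
    with raised? s T₁ e d y x | least _ plus⊆raise raise-transitive x y 1≤x x<y y≤n
  ... | yes R | _  = inj₂ R
  ... | no _  | le = inj₁ le

-- Spines: trees with maximal cardinalities.

Has : (m n : ℕ) → Tree → Set
Has m n T = ∀ x → m < x → x ≤ n → ∃[ p ] At x T p

leaf-Has : ∀ {n} → Has n n leaf
leaf-Has x n<x x≤n = contradiction x≤n (<⇒≱ n<x)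

Descends : Tree → (y i x : ℕ) → Set
Descends T y i x = ∃[ p ] ∃[ q ] (At y T p × At x T (p ++ i ∷ q))

Descends-child : Nth ts j t → Descends t y i x → Descends (node c ts) y i x
Descends-child n (p , q , α , β) = _ ∷ p , q , child n α , child n β

card-Descends : IsSDecreasing s T₁ → Descends T₁ y i x → card s T₁ y x ≡ i
card-Descends {s} {y = y} sd (p , q , α , β) =
  trans (card-At sd α β) (cardAddr-descendant (val s y) p)

-- The labels from `lo + 1` to `lo + j` form a chain on top of `B`, always descending into the last
-- child, which makes their cardinalities with all labels beneath them maximal.
spine : List ℕ → Tree → (lo j : ℕ) → Tree
spine s B lo zero    = B
spine s B lo (suc j) = node (suc j + lo) (replicate (val s (suc j + lo)) leaf ++ spine s B lo j ∷ [])

spinePath : List ℕ → (lo j : ℕ) → List ℕ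
spinePath s lo zero    = []
spinePath s lo (suc j) = val s (suc j + lo) ∷ spinePath s lo j

Nth-after-leaves : ∀ k → Nth ts i t → Nth (replicate k leaf ++ ts) (k + i) t
Nth-after-leaves zero    n = n
Nth-after-leaves (suc k) n = suc (Nth-after-leaves k n)

Nth-past-leaves : ∀ k → Nth (replicate k leaf ++ t ∷ ts) k t
Nth-past-leaves {t = t} {ts = ts} k =
  subst (λ m → Nth (replicate k leaf ++ t ∷ ts) m t) (+-identityʳ k) (Nth-after-leaves k zero)

labelsF-leaves : ∀ k → labelsF (replicate k leaf ++ ts) ≡ labelsF ts
labelsF-leaves zero    = refl
labelsF-leaves (suc k) = labelsF-leaves k

spine-base : ∀ {B lo} j → At x B p → At x (spine s B lo j) (spinePath s lo j ++ p)
spine-base zero    α = α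
spine-base (suc j) α = child (Nth-past-leaves _) (spine-base j α)

spine-Has : ∀ {B m lo} j → Has m lo B → Has m (j + lo) (spine s B lo j)
spine-Has         zero    has x m<x x≤   = has x m<x x≤
spine-Has {lo = lo} (suc j) has x m<x x≤ with x ≟ suc j + lo
... | yes refl = [] , root
... | no  x≢   with p , α ← spine-Has j has x m<x (≤-pred (≤∧≢⇒< x≤ x≢)) =
  _ , child (Nth-past-leaves _) α

spine-Descends-base : ∀ {B lo} j → Descends B y i x → Descends (spine s B lo j) y i x
spine-Descends-base zero    δ = δ
spine-Descends-base (suc j) δ = Descends-child (Nth-past-leaves _) (spine-Descends-base j δ)

spine-Descends : ∀ {B m lo} j → Has m lo B → m < x → x < y → lo < y → y ≤ j + lo →
                 Descends (spine s B lo j) y (val s y) x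
spine-Descends zero has m<x x<y lo<y y≤ = contradiction y≤ (<⇒≱ lo<y)
spine-Descends {y = y} {lo = lo} (suc j) has m<x x<y lo<y y≤ with y ≟ suc j + lo
... | yes refl with p , α ← spine-Has j has _ m<x (≤-pred x<y) =
  [] , p , root , child (Nth-past-leaves _) α
... | no y≢ = Descends-child (Nth-past-leaves _)
  (spine-Descends j has m<x x<y lo<y (≤-pred (≤∧≢⇒< y≤ y≢)))

-- Listed in the order in which `labels` meets a spine, so that `labels-spine` is an equality and
-- not merely a permutation.
interval : (lo j : ℕ) → List ℕ
interval lo zero    = []
interval lo (suc j) = suc j + lo ∷ interval lo j

down : ℕ → List ℕ
down n = map suc (downFrom n)

interval-down : ∀ lo j → interval lo j ++ down lo ≡ down (j + lo)
interval-down lo zero    = refl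
interval-down lo (suc j) = cong (suc j + lo ∷_) (interval-down lo j)

down↭range1 : ∀ n → down n ↭ range1 n
down↭range1 n = map⁺ suc (↭-trans (↭-reflexive (sym (reverse-upTo n))) (↭-reverse (upTo n)))

down-≤ : ∀ n → All (_≤ n) (down n)
down-≤ zero    = []
down-≤ (suc n) = ≤-refl ∷ All.map m≤n⇒m≤1+n (down-≤ n)

labels-spine : ∀ s B lo j → labels (spine s B lo j) ≡ interval lo j ++ labels B
labels-spine s B lo zero    = refl
labels-spine s B lo (suc j) = cong (suc j + lo ∷_)
  (trans (labelsF-leaves (val s (suc j + lo)))
  (trans (++-identityʳ _) (labels-spine s B lo j)))

spine-bounded : ∀ {B} lo j → All (_≤ lo) (labels B) → All (_≤ j + lo) (labels (spine s B lo j))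
spine-bounded {s} {B} lo j b rewrite labels-spine s B lo j =
  All.++⁺ (below j) (All.map (λ le → ≤-trans le (m≤n+m lo j)) b)
  where
  below : ∀ j → All (_≤ j + lo) (interval lo j)
  below zero    = []
  below (suc j) = ≤-refl ∷ All.map m≤n⇒m≤1+n (below j)

spine-Shape : ∀ {B} lo j → Shape s B → All (_≤ lo) (labels B) → Shape s (spine s B lo j)
spine-Shape     lo zero    sh b = sh
spine-Shape {s} lo (suc j) sh b = node
  (trans (length-++ (replicate m leaf)) (trans (cong (_+ 1) (length-replicate m)) (+-comm m 1)))
  (All.++⁺ (All.replicate⁺ m []) (All.map s≤s (spine-bounded lo j b) ∷ []))
  (All.++⁺ (All.replicate⁺ m leaf) (spine-Shape lo j sh b ∷ []))
  where m = val s (suc j + lo)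

-- The explicit upper bound for trees avoiding a label.

-- The label `d` is `suc (i + e)`: `i` counts the labels strictly between `e` and `d`, and `j` those
-- above `d`. Labels up to `e` go into child `k` of `d`, those in between into its last child, and
-- the larger ones on top. The bound `k<` keeps the two children apart.
module Fork (s : List ℕ) (e i j k : ℕ) (n≡ : j + suc (i + e) ≡ length s)
            (k< : k < val s (suc (i + e))) where

  private
    f m : ℕ
    f = suc (i + e)
    -- The number of leaves between the two occupied children; by `k<` the subtraction is exact.
    m = val s f ∸ suc k

    k+1+m : k + suc m ≡ val s f
    k+1+m = trans (+-suc k m) (m+[n∸m]≡n k<)

  below middle : Tree
  below  = spine s leaf 0 e
  middle = spine s leaf e i

  subtrees : List Tree
  subtrees = replicate k leaf ++ below ∷ replicate m leaf ++ middle ∷ []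

  forkNode fork : Tree
  forkNode = node f subtrees
  fork = spine s forkNode f j

  below-Nth : Nth subtrees k below
  below-Nth = Nth-past-leaves k

  middle-Nth : Nth subtrees (val s f) middle
  middle-Nth = subst (λ l → Nth subtrees l middle) k+1+m (Nth-after-leaves k (suc (Nth-past-leaves m)))

  below-Has : Has 0 e below
  below-Has = subst (λ l → Has 0 l below) (+-identityʳ e) (spine-Has e leaf-Has)

  middle-Has : Has e (i + e) middle
  middle-Has = spine-Has i leaf-Has

  forkNode-Has : Has 0 f forkNode
  forkNode-Has x 0<x x≤f with x ≟ f
  ... | yes refl = [] , root
  ... | no  x≢f  with x ≤? e
  ...   | yes x≤e = _ , child below-Nth (proj₂ (below-Has x 0<x x≤e))
  ...   | no  x≰e = _ , child middle-Nth (proj₂ (middle-Has x (≰⇒> x≰e) (≤-pred (≤∧≢⇒< x≤f x≢f))))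

  -- The smaller labels stand further left and are met first; exchanging the two blocks gives the
  -- decreasing list.
  labels-forkNode : labels forkNode ↭ down f
  labels-forkNode = prep f (↭-trans (↭-reflexive labels≡)
    (↭-trans (++-comm (down e) (interval e i)) (↭-reflexive (interval-down e i))))
    where
    labels≡ : labelsF subtrees ≡ down e ++ interval e i
    labels≡ = trans (labelsF-leaves k) (cong₂ _++_
      (trans (labels-spine s leaf 0 e) (trans (interval-down 0 e) (cong down (+-identityʳ e))))
      (trans (labelsF-leaves m) (trans (++-identityʳ _)
        (trans (labels-spine s leaf e i) (++-identityʳ _)))))

  forkNode-Shape : Shape s forkNode
  forkNode-Shape = node
    (trans (length-++ (replicate k leaf)) (trans (cong₂ _+_ (length-replicate k)
      (cong suc (trans (length-++ (replicate m leaf)) (cong (_+ 1) (length-replicate m)))))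
      (trans (cong (k +_) (+-comm (suc m) 1)) (trans (+-suc k (suc m)) (cong suc k+1+m)))))
    (All.++⁺ (All.replicate⁺ k []) (All.map (λ x≤ → s≤s (≤-trans x≤ e+0≤i+e)) (spine-bounded 0 e []) ∷
      All.++⁺ (All.replicate⁺ m []) (All.map s≤s (spine-bounded e i []) ∷ [])))
    (All.++⁺ (All.replicate⁺ k leaf) (spine-Shape 0 e leaf [] ∷
      All.++⁺ (All.replicate⁺ m leaf) (spine-Shape e i leaf [] ∷ [])))
    where
    e+0≤i+e : e + 0 ≤ i + e
    e+0≤i+e = ≤-trans (≤-reflexive (+-identityʳ e)) (m≤n+m e i)

  fork-IsSDecreasing : IsSDecreasing s fork
  fork-IsSDecreasing =
    spine-Shape f j forkNode-Shape (All-resp-↭ (↭-sym labels-forkNode) (down-≤ f)) ,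
    ↭-trans (↭-reflexive (labels-spine s forkNode f j))
    (↭-trans (++⁺ˡ (interval f j) labels-forkNode)
    (↭-trans (↭-reflexive (interval-down f j))
    (subst (λ n → down (j + f) ↭ range1 n) n≡ (down↭range1 (j + f)))))

  -- Outside the exceptional range `x` lies below the last child of `y`: either `y` is on a spine
  -- with `x` beneath it, or `y` is `f` and `x` is in `middle`.
  fork-full : 1 ≤ x → x < y → y ≤ length s →
              card s fork y x ≡ val s y ⊎ (x ≤ e × e < y × y ≤ f)
  fork-full {x} {y} 1≤x x<y y≤n with y ≤? f
  ... | no y≰f = inj₁ (card-Descends fork-IsSDecreasing
    (spine-Descends j forkNode-Has 1≤x x<y (≰⇒> y≰f) (subst (y ≤_) (sym n≡) y≤n)))
  ... | yes y≤f with y ≤? e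
  ...   | yes y≤e = inj₁ (card-Descends fork-IsSDecreasing (spine-Descends-base j
    (Descends-child below-Nth (spine-Descends e leaf-Has
      1≤x x<y (<-trans 1≤x x<y) (subst (y ≤_) (sym (+-identityʳ e)) y≤e)))))
  ...   | no y≰e with x ≤? e
  ...     | yes x≤e = inj₂ (x≤e , ≰⇒> y≰e , y≤f)
  ...     | no x≰e with y ≟ f
  ...       | yes refl = inj₁ (card-Descends fork-IsSDecreasing (spine-Descends-base j
    ([] , _ , root , child middle-Nth (proj₂ (middle-Has x (≰⇒> x≰e) (≤-pred x<y))))))
  ...       | no y≢f = inj₁ (card-Descends fork-IsSDecreasing (spine-Descends-base j
    (Descends-child middle-Nth (spine-Descends i leaf-Has
      (≰⇒> x≰e) x<y (≰⇒> y≰e) (≤-pred (≤∧≢⇒< y≤f y≢f))))))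

  fork-at : 1 ≤ x → x ≤ e → card s fork f x ≡ k
  fork-at {x} 1≤x x≤e = card-Descends fork-IsSDecreasing (spine-Descends-base j
    ([] , _ , root , child below-Nth (proj₂ (below-Has x 1≤x x≤e))))

  -- By `k<`, all of `below` stands to the left of `middle`.
  fork-zero : 1 ≤ x → x ≤ e → e < y → y < f → card s fork y x ≡ 0
  fork-zero {x} {y} 1≤x x≤e e<y y<f = trans
    (card-At fork-IsSDecreasing
      (spine-base j (child middle-Nth (proj₂ (middle-Has y e<y (≤-pred y<f)))))
      (spine-base j (child below-Nth (proj₂ (below-Has x 1≤x x≤e)))))
    (cardAddr-left (val s y) (spinePath s f j) k<)

  -- If #(c,b) is not maximal, then b ≤ e < c ≤ f. Hence also a < e, so #(c,a) is `k` like #(c,b)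
  -- when c = f, and 0 otherwise.
  fork-IsTamari : IsTamari s fork
  fork-IsTamari = fork-IsSDecreasing , tam
    where
    tam : ∀ a b c → 1 ≤ a → a < b → b < c → c ≤ length s → card s fork c a ≤ card s fork c b
    tam a b c 1≤a a<b b<c c≤n with fork-full (<⇒≤ (≤-<-trans 1≤a a<b)) b<c c≤n
    ... | inj₁ eq = subst (_ ≤_) (sym eq) (card-≤ fork-IsSDecreasing c a)
    ... | inj₂ (b≤e , e<c , c≤f) with c ≟ f
    ...   | yes refl = ≤-reflexive (trans (fork-at 1≤a (<⇒≤ (<-≤-trans a<b b≤e)))
      (sym (fork-at (<⇒≤ (≤-<-trans 1≤a a<b)) b≤e)))
    ...   | no c≢f = subst (_≤ card s fork c b)
      (sym (fork-zero 1≤a (<⇒≤ (<-≤-trans a<b b≤e)) e<c (≤∧≢⇒< c≤f c≢f))) z≤n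

  -- On exceptional pairs the Tamari inequality of `V` replaces `x` by `e`, so conditions on `e`
  -- alone suffice.
  fork-greatest : ∀ {V} → IsTamari s V → card s V f e ≤ k →
                  (∀ y → e < y → y < f → card s V y e ≡ 0) → WeakLe s V fork
  fork-greatest {V} (sd , tam) ≤k zeros x y 1≤x x<y y≤n with fork-full 1≤x x<y y≤n
  ... | inj₁ eq = subst (_ ≤_) (sym eq) (card-≤ sd y x)
  ... | inj₂ (x≤e , e<y , y≤f) = ≤-trans to-e from-e
    where
    to-e : card s V y x ≤ card s V y e
    to-e with x ≟ e
    ... | yes refl = ≤-refl
    ... | no  x≢e  = tam x e y 1≤x (≤∧≢⇒< x≤e x≢e) e<y y≤n
    from-e : card s V y e ≤ card s fork y x
    from-e with y ≟ f
    ... | yes refl = ≤-trans ≤k (≤-reflexive (sym (fork-at 1≤x x≤e)))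
    ... | no y≢f   = subst (_≤ card s fork y x) (sym (zeros y e<y (≤∧≢⇒< y≤f y≢f))) z≤n

greatest-avoiding : 1 ≤ e → e < d → d ≤ length s → k < val s d →
  ∃[ K ] (IsTamari s K × card s K d e ≡ k ×
    (∀ {V} → IsTamari s V → card s V d e ≤ k →
       (∀ y → e < y → y < d → card s V y e ≡ 0) → WeakLe s V K))
greatest-avoiding {e} {d} {s} {k} 1≤e e<d d≤n k<
  -- The gaps d - e - 1 and n - d, with n the length of `s`.
  with i , refl ← m≤n⇒∃[o]m+o≡n e<d | j , n≡ ← m≤n⇒∃[o]m+o≡n d≤n
  rewrite +-comm e i = fork , fork-IsTamari , fork-at 1≤e ≤-refl , fork-greatest
  where open Fork s e i j k (trans (+-comm j (suc (i + e))) n≡) k<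

-- Labels along saturated chains.

module _ {s : List ℕ} where

  WeakLe-trans : ∀ X Y Z → WeakLe s X Y → WeakLe s Y Z → WeakLe s X Z
  WeakLe-trans X Y Z f g x y 1≤x x<y y≤n = ≤-trans (f x y 1≤x x<y y≤n) (g x y 1≤x x<y y≤n)

  ascent-bounds : IsTamari s T₁ → Ascent s T₁ a b → 1 ≤ a × b ≤ length s
  ascent-bounds (sd , _) (_ , ch , _) with _ , _ , β , α ← child-At ch =
    proj₁ (label-bounds sd α) , proj₂ (label-bounds sd β)

  -- An ascent has #(b,a) < s(b), so the cap in `plus` does not take effect.
  rotation-increases : ∀ {Z} → IsTamari s T₁ → Ascent s T₁ a b → Rotation s T₁ a b Z →
                       card s T₁ b a < card s Z b a
  rotation-increases {T₁} {a} {b} {Z} tam asc@(a<b , _ , <val) (_ , sub , _)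
    with 1≤a , b≤n ← ascent-bounds tam asc
    with le ← sub a b 1≤a a<b b≤n
    rewrite ≡ᵇ-refl a | ≡ᵇ-refl b | m≤n⇒m⊓n≡m <val = le

  chain-WeakLe : ∀ {lab X Y} → SatChain s lab X Y ls → WeakLe s X Y
  chain-WeakLe done                  x y _ _ _ = ≤-refl
  chain-WeakLe {X = X} {Y} (step {Z = Z} (_ , _ , le , _) ch) = WeakLe-trans X Z Y le (chain-WeakLe ch)

  -- If e ≢ a, rotating u along (a , b) keeps it below the greatest tree in which e stays
  -- in the k-th subtree of d and is no descendant of a label strictly between e and d.
  rotation-zero : ∀ {u v} → IsTamari s u → Ascent s u a b → Rotation s u a b v → e ≢ a →
    IsTamari s T₁ → WeakLe s u T₁ → Ascent s T₁ e d →
    card s v d e ≤ card s T₁ d e × (∀ y → e < y → y < d → card s v y e ≡ 0)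
  rotation-zero {a} {b} {e} {T₁} {d} {u} {v} tamU (a<b , chU , _) rot e≢a tam u≤T
                asc@(e<d , ch , _)
    with 1≤e , d≤n ← ascent-bounds tam asc = bound , zeros
    where
    u-zero : ∀ {y} → e < y → y < d → card s u y e ≡ 0
    u-zero {y} e<y y<d = n≤0⇒n≡0 (≤-trans (u≤T e y 1≤e e<y (<⇒≤ (<-≤-trans y<d d≤n)))
      (≤-reflexive (child-between {T₁ = T₁} tam ch e<y y<d)))
    unraised : ∀ {y} → y ≤ d → ¬ Raised s u a b y e
    unraised y≤d (refl , inj₁ e≡a) = e≢a e≡a
    unraised y≤d (refl , inj₂ (e<a , pos)) =
      contradiction (subst (0 <_) (u-zero e<a (<-≤-trans a<b y≤d)) pos) λ ()
    v≤u : ∀ {y} → e < y → y ≤ d → card s v y e ≤ card s u y e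
    v≤u e<y y≤d with rotation-raises {T₁ = u} tamU chU a<b {Z = v} rot 1≤e e<y (≤-trans y≤d d≤n)
    ... | inj₁ le = le
    ... | inj₂ R  = contradiction R (unraised y≤d)
    bound = ≤-trans (v≤u e<d ≤-refl) (u≤T e d 1≤e e<d d≤n)
    zeros : ∀ y → e < y → y < d → card s v y e ≡ 0
    zeros y e<y y<d = n≤0⇒n≡0 (≤-trans (v≤u e<y (<⇒≤ y<d)) (≤-reflexive (u-zero e<y y<d)))

  -- Were `e` neither label, `v` and `w`, hence `J`, would lie below a tree `K` agreeing with `T` at
  -- (d,e); but `Z`, below `J`, already exceeds that value.
  join-label : ∀ {u v w a b a′ b′ e d T Z J} → IsTamari s u →
    Ascent s u a b → Rotation s u a b v → Ascent s u a′ b′ → Rotation s u a′ b′ w →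
    IsJoin s v w J → IsTamari s T → WeakLe s u T → Ascent s T e d → Rotation s T e d Z →
    WeakLe s Z J → e ≡ a ⊎ e ≡ a′
  join-label {a = a} {a′ = a′} {e = e} {d = d} {T = T} {J = J} tamU asc rot asc′ rot′ (_ , _ , _ , least)
             tam u≤T ascT rotT Z≤J
    with e ≟ a | e ≟ a′
  ... | yes e≡a | _        = inj₁ e≡a
  ... | no _    | yes e≡a′ = inj₂ e≡a′
  ... | no e≢a  | no e≢a′
    with 1≤e , d≤n ← ascent-bounds tam ascT
    with K , tamK , K≡ , greatest ← greatest-avoiding 1≤e (proj₁ ascT) d≤n (proj₂ (proj₂ ascT))
    with le , zs ← rotation-zero tamU asc rot e≢a tam u≤T ascT
       | le′ , zs′ ← rotation-zero tamU asc′ rot′ e≢a′ tam u≤T ascT =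
    contradiction
      (<-≤-trans (rotation-increases tam ascT rotT)
        (≤-trans (Z≤J e d 1≤e (proj₁ ascT) d≤n)
          (least K tamK (greatest (proj₁ rot) le zs) (greatest (proj₁ rot′) le′ zs′)
             e d 1≤e (proj₁ ascT) d≤n)))
      (subst (λ m → ¬ card s T d e < m) (sym K≡) (<-irrefl refl))

  module _ {lab : Tree → Tree → ℕ}
    (rotates : ∀ T Z → TamCover s T Z → ∃[ b ] (Ascent s T (lab T Z) b × Rotation s T (lab T Z) b Z))
    where

    -- The chain may start at any `T` above `u`, so the induction moves along it while `u`, `v`, `w`
    -- and `J` stay fixed.
    chain-labels : ∀ {u v w a b a′ b′ T J} → IsTamari s u →
      Ascent s u a b → Rotation s u a b v → Ascent s u a′ b′ → Rotation s u a′ b′ w →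
      IsJoin s v w J → WeakLe s u T → SatChain s lab T J ls →
      All (λ l → l ≡ a ⊎ l ≡ a′) ls
    chain-labels tamU asc rot asc′ rot′ join u≤T done = []
    chain-labels {u = u} {T = T} tamU asc rot asc′ rot′ join u≤T
                 (step {Z = Z} cov@(tam , _ , T≤Z , _) ch)
      with d , ascT , rotT ← rotates _ _ cov =
      join-label tamU asc rot asc′ rot′ join tam u≤T ascT rotT (chain-WeakLe ch) ∷
      chain-labels tamU asc rot asc′ rot′ join (WeakLe-trans u T Z u≤T T≤Z) ch

    -- A step labelled a′ raises (b , a) only if a lies in a later subtree of a′, and that
    -- in turn can only be brought about by a step labelled a.
    label-occurs : ∀ {a b a′ T J} → 1 ≤ a → a < b → b ≤ length s → card s T b a < card s J b a →
      (a < a′ → a′ < b → card s T a′ a ≡ 0) → SatChain s lab T J ls →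
      All (λ l → l ≡ a ⊎ l ≡ a′) ls → a ∈ ls
    label-occurs 1≤a a<b b≤n lt zero-inv done _ = contradiction refl (<⇒≢ lt)
    label-occurs 1≤a a<b b≤n lt zero-inv (step cov ch) (inj₁ eq ∷ _) = here (sym eq)
    label-occurs {a = a} {b} {a′} {T} 1≤a a<b b≤n lt zero-inv
                 (step {Z = Z} cov@(tam , _) ch) (inj₂ eq ∷ lbls)
      -- The labels `a` and `a′` are not assumed distinct here.
      with lab T Z ≟ a | rotates _ _ cov
    ... | yes l≡a | _ = here (sym l≡a)
    ... | no  l≢a | d , (l<d , chT , _) , rot with refl ← eq =
      there (label-occurs 1≤a a<b b≤n
        -- If (b,a) were raised, then d = b and either a = a′, excluded in this case, or #(a′,a) >
        -- 0, against `zero-inv`.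
        (≤-<-trans (unraised ≤-refl a<b b≤n λ { (refl , inj₁ a≡l) → l≢a (sym a≡l)
          ; (refl , inj₂ (a<l , pos)) → contradiction (subst (0 <_) (zero-inv a<l l<d) pos) λ () }) lt)
        -- The invariant survives: raising (a′,a) would need d = a′, whereas a′ < d.
        (λ a<l l<b → n≤0⇒n≡0 (≤-trans
          (unraised {y = a′} ≤-refl a<l (<⇒≤ (<-≤-trans l<b b≤n)) λ { (l≡d , _) → <⇒≢ l<d l≡d })
          (≤-reflexive (zero-inv a<l l<b))))
        ch lbls)
      where
      unraised : ∀ {y z} → y ≤ z → a < y → y ≤ length s → ¬ Raised s T a′ d y a →
                 card s Z y a ≤ card s T y a
      unraised _ a<y y≤n ¬R with rotation-raises {T₁ = T} tam chT l<d {Z = Z} rot 1≤a a<y y≤n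
      ... | inj₁ le = le
      ... | inj₂ R  = contradiction R ¬R

-- The conditions of an SB-labeling.

theorem4p13 : (s : List ℕ) (lab : Tree → Tree → ℕ) →
    (∀ T Z → TamCover s T Z → ∃[ b ] (Ascent s T (lab T Z) b × Rotation s T (lab T Z) b Z)) →
    ∀ u v w → TamCover s u v → TamCover s u w → v ≢ w →
    (lab u v ≢ lab u w) ×
    (∀ J → IsJoin s v w J → ∀ ls → SatChain s lab u J ls →
    (lab u v ∈ ls) × (lab u w ∈ ls) × All (λ l → (l ≡ lab u v) ⊎ (l ≡ lab u w)) ls)
theorem4p13 s lab rotates u v w cv@(tamU , tamV , u≤v , u≢v , _)
           cw@(_ , tamW , u≤w , u≢w , between) v≢w
  with b , asc , rot ← rotates u v cv | b′ , asc′ , rot′ ← rotates u w cw =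
  distinct , λ J join ls chain →
    let lbls = chain-labels rotates tamU asc rot asc′ rot′ join (λ _ _ _ _ _ → ≤-refl) chain
        _ , v≤J , w≤J , _ = join
    in occurs asc rot v≤J (zero-at asc) chain lbls ,
       occurs asc′ rot′ w≤J (zero-at asc′) chain (All.map swap lbls) ,
       lbls
  where
  -- The invariant of `label-occurs` at the bottom of the chain, where `a` is a child of `b`.
  zero-at : ∀ {a b a′} → Ascent s u a b → a < a′ → a′ < b → card s u a′ a ≡ 0
  zero-at (_ , ch , _) = child-between {T₁ = u} tamU ch

  occurs : ∀ {a b a′ Z J ls} → Ascent s u a b → Rotation s u a b Z → WeakLe s Z J →
           (a < a′ → a′ < b → card s u a′ a ≡ 0) → SatChain s lab u J ls →
           All (λ l → l ≡ a ⊎ l ≡ a′) ls → a ∈ ls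
  occurs asc rot Z≤J zeros chain lbls with 1≤a , b≤n ← ascent-bounds tamU asc =
    label-occurs rotates 1≤a (proj₁ asc) b≤n
      (<-≤-trans (rotation-increases tamU asc rot) (Z≤J _ _ 1≤a (proj₁ asc) b≤n))
      zeros chain lbls

  -- Equal labels have the same parent in `u`, so both rotations close the same multiset. Minimality
  -- puts `v` below `w`, and since `w` covers `u`, `v` is one of the two.
  distinct : lab u v ≢ lab u w
  distinct eq with rotates u v cv | rotates u w cw
  ... | b , (_ , ch , _) , (_ , _ , _ , leastV) | b′ , (_ , ch′ , _) , (_ , subW , transW , _)
    rewrite eq with refl ← parent-unique (proj₁ tamU) ch ch′
    with between v tamV u≤v (leastV _ subW transW)
  ... | inj₁ v≡u = u≢v (sym v≡u)
  ... | inj₂ v≡w = v≢w v≡w
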